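{- The maximal length of an oasis base $b$ is $2$ for $b=2$, $6$ for $b=4$, $5$ for $b=6$, $8$ for each $b\in\{8,10,12,14,16,18\}$, and $9$ for $b=20$. That is, for each of these $b$, there exists a $k$-oasis base $b$ with $k$ equal to the stated value, and no $k$-oasis base $b$ exists with $k$ larger than the stated value.
   Context: For integers $c\geq 0$ and $b\geq 2$, the augmented generalized happy function $S_{[c,b]}:\mathbb{Z}^+\to\mathbb{Z}^+$ is defined by $S_{[c,b]}\left(\sum_{i=0}^n a_i b^i\right)=c+\sum_{i=0}^n a_i^2$, where $0\le a_i\le b-1$, $a_n\neq 0$ (the base $b$ expansion). A positive integer $a$ is a fixed point of $S_{[c,b]}$ if $S_{[c,b]}(a)=a$. For $b\geq 2$ and $k\in\mathbb{Z}^+$, a $k$-oasis base $b$ is a set of $k$ consecutive non-negative integers $c$ such that for each of them $S_{[c,b]}$ has at least one fixed point; its length is $k$. -}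

module Defs where

open import Data.Nat using (ℕ; zero; suc; _+_; _*_; _^_; _<_; NonZero)
open import Data.Nat.DivMod using (_/_; _%_)
open import Data.Product using (Σ; _×_; ∃)
open import Relation.Binary.PropositionalEquality using (_≡_)
open import Relation.Nullary using (¬_)

-- Sum of the squares of the base-b digits of n, computed with fuel.
-- The base-b digits of n > 0 are n % b, (n / b) % b, ... (until the
-- quotient reaches 0).  For b ≥ 2 each step strictly decreases n, so
-- fuel n is always enough; leading zero digits never arise.
sqDigitSumFuel : ℕ → (b : ℕ) → .{{NonZero b}} → ℕ → ℕ
sqDigitSumFuel zero    b zero    = 0
sqDigitSumFuel zero    b (suc n) = 0
sqDigitSumFuel (suc f) b zero    = 0
sqDigitSumFuel (suc f) b (suc n) =
  ((suc n) % b) ^ 2 + sqDigitSumFuel f b ((suc n) / b)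

sqDigitSum : (b : ℕ) → .{{NonZero b}} → ℕ → ℕ
sqDigitSum b n = sqDigitSumFuel n b n

S : (c b : ℕ) → .{{NonZero b}} → ℕ → ℕ
S c b a = c + sqDigitSum b a

IsFixedPoint : (c b : ℕ) → .{{NonZero b}} → ℕ → Set
IsFixedPoint c b a = (0 < a) × (S c b a ≡ a)

HasFixedPoint : (c b : ℕ) → .{{NonZero b}} → Set
HasFixedPoint c b = ∃ λ a → IsFixedPoint c b a

IsOasis : (b : ℕ) → .{{NonZero b}} → (k c₀ : ℕ) → Set
IsOasis b k c₀ = ∀ i → i < k → HasFixedPoint (c₀ + i) b

MaxOasisLength : (b : ℕ) → .{{NonZero b}} → ℕ → Set
MaxOasisLength b K =
  (∃ λ c₀ → IsOasis b K c₀) × (∀ k c₀ → K < k → ¬ IsOasis b k c₀)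

-- Write a = p b³ + r with r < b³ and let s denote the digit square sum.  A fixed
-- point a of S c b satisfies c = (p b³ − s p) + (r − s r), so the admissible c lie
-- in translates, by p b³ − s p, of the finite set E = { r − s r | r < b³ }.
-- Since s (p + 1) ≤ s p + 2b − 3, consecutive translates are further apart than the
-- diameter of E plus one.  A run of consecutive c therefore stays within a single
-- translate, and the longest run in E is computed.  E is a Minkowski sum of
-- one set for each of the three digits, and is stored as a bitmap.
module Submission where

open import Defs
open import Data.Bool using (Bool; true; false; _∨_; T)
open import Data.Bool.Properties using (∨-zeroʳ)
open import Data.Empty using (⊥)
open import Data.Fin using (toℕ; fromℕ<)
open import Data.Fin.Properties using (all?; toℕ-fromℕ<)
open import Data.List using (List; []; _∷_; length)
open import Data.Nat using (ℕ; zero; suc; pred; _+_; _*_; _∸_; _^_; _≤_; _<_; z≤n; s≤s; NonZero; _≟_; _<?_)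
open import Data.Nat.DivMod
open import Data.Nat.Divisibility using (n∣m*n)
open import Data.Nat.Induction using (<-rec)
open import Data.Nat.Properties
open import Data.Nat.Tactic.RingSolver using (solve-∀)
open import Data.Product using (_×_; _,_; ∃₂; proj₁; proj₂)
open import Data.Sum using (inj₁; inj₂)
open import Data.Vec using (Vec; []; _∷_; lookup)
open import Relation.Binary using (tri<; tri≈; tri>)
open import Relation.Binary.PropositionalEquality
  using (_≡_; refl; sym; trans; cong; cong₂; subst; module ≡-Reasoning)
open import Relation.Nullary using (¬_; contradiction)
open import Relation.Nullary.Decidable using (True; toWitness; _×-dec_)

-- Finite sets of naturals as bitmaps, and their runs of consecutive members

Member : List Bool → ℕ → Set
Member []       n       = ⊥
Member (x ∷ xs) zero    = T x
Member (x ∷ xs) (suc n) = Member xs n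

infixr 6 _∪_ _⊕_

_∪_ : List Bool → List Bool → List Bool
[]       ∪ ys       = ys
(x ∷ xs) ∪ []       = x ∷ xs
(x ∷ xs) ∪ (y ∷ ys) = (x ∨ y) ∷ (xs ∪ ys)

-- Minkowski sum by shift and or: a `true` at position m contributes a copy of `ys` moved up by m.
_⊕_ : List Bool → List Bool → List Bool
[]           ⊕ ys = []
(true  ∷ xs) ⊕ ys = ys ∪ (false ∷ (xs ⊕ ys))
(false ∷ xs) ⊕ ys = false ∷ (xs ⊕ ys)

singleton : ℕ → List Bool
singleton zero    = true ∷ []
singleton (suc n) = false ∷ singleton n

image : (ℕ → ℕ) → ℕ → List Bool
image f zero    = []
image f (suc n) = singleton (f n) ∪ image f n

Member-<-length : ∀ xs {n} → Member xs n → n < length xs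
Member-<-length (x ∷ xs) {zero}  m = s≤s z≤n
Member-<-length (x ∷ xs) {suc n} m = s≤s (Member-<-length xs m)

∪-left : ∀ xs ys {n} → Member xs n → Member (xs ∪ ys) n
∪-left (x ∷ xs)    []       m = m
∪-left (true ∷ xs) (y ∷ ys) {zero}  m = m
∪-left (x ∷ xs)    (y ∷ ys) {suc n} m = ∪-left xs ys m

∪-right : ∀ xs ys {n} → Member ys n → Member (xs ∪ ys) n
∪-right []       ys          m = m
∪-right (x ∷ xs) (true ∷ ys) {zero}  m = subst T (sym (∨-zeroʳ x)) m
∪-right (x ∷ xs) (y ∷ ys)    {suc n} m = ∪-right xs ys m

-- With `image-mem` this puts every attained value into `E`, the inclusion that an upper bound on
-- runs requires.
⊕-+ : ∀ xs ys {m n} → Member xs m → Member ys n → Member (xs ⊕ ys) (m + n)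
⊕-+ (true  ∷ xs) ys {zero}  p q = ∪-left ys _ q
⊕-+ (true  ∷ xs) ys {suc m} p q = ∪-right ys (false ∷ (xs ⊕ ys)) (⊕-+ xs ys p q)
⊕-+ (false ∷ xs) ys {suc m} p q = ⊕-+ xs ys p q

singleton-self : ∀ n → Member (singleton n) n
singleton-self zero    = _
singleton-self (suc n) = singleton-self n

image-mem : ∀ f {n d} → d < n → Member (image f n) (f d)
image-mem f {suc n} {d} d<1+n with m<1+n⇒m<n∨m≡n d<1+n
... | inj₁ d<n  = ∪-right (singleton (f n)) _ (image-mem f d<n)
... | inj₂ refl = ∪-left (singleton (f n)) _ (singleton-self (f n))

-- The second argument is the number of further members allowed in the current run.
runs≤ : ℕ → ℕ → List Bool → Bool
runs≤ K j       []           = true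
runs≤ K j       (false ∷ xs) = runs≤ K K xs
runs≤ K zero    (true  ∷ xs) = false
runs≤ K (suc j) (true  ∷ xs) = runs≤ K j xs

-- The range `i ≤ j` has `suc j` positions, one more than the allowance `j`, so the scan would have
-- to meet a gap or the end of the list inside the run.
no-initial-run : ∀ K j xs → T (runs≤ K j xs) → ¬ (∀ i → i ≤ j → Member xs i)
no-initial-run K j       []           t run = run 0 z≤n
no-initial-run K j       (false ∷ xs) t run = run 0 z≤n
no-initial-run K (suc j) (true  ∷ xs) t run =
  no-initial-run K j xs t (λ i i≤j → run (suc i) (s≤s i≤j))

-- Scanning the first `n` entries changes the allowance but keeps it at most `K`, so at position `n`
-- the claim reduces to `no-initial-run`.
no-long-run : ∀ K j xs n → T (runs≤ K j xs) → j ≤ K →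
  ¬ (∀ i → i ≤ K → Member xs (n + i))
no-long-run K j       xs           zero    t j≤K run =
  no-initial-run K j xs t (λ i i≤j → run i (≤-trans i≤j j≤K))
no-long-run K j       []           (suc n) t j≤K run = run 0 z≤n
no-long-run K j       (false ∷ xs) (suc n) t j≤K run = no-long-run K K xs n t ≤-refl run
no-long-run K (suc j) (true  ∷ xs) (suc n) t j≤K run = no-long-run K j xs n t (<⇒≤ j≤K) run

-- Recursion and growth of the digit square sum

module _ (b : ℕ) .{{_ : NonZero b}} (1<b : 1 < b) where

  -- Each division by `b` lowers a positive argument, so fuel that bounds the argument keeps
  -- bounding it.
  sqDigitSumFuel-irrelevant : ∀ f g n → n ≤ f → n ≤ g →
    sqDigitSumFuel f b n ≡ sqDigitSumFuel g b n
  sqDigitSumFuel-irrelevant zero    zero    zero    _ _ = refl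
  sqDigitSumFuel-irrelevant zero    (suc g) zero    _ _ = refl
  sqDigitSumFuel-irrelevant (suc f) zero    zero    _ _ = refl
  sqDigitSumFuel-irrelevant (suc f) (suc g) zero    _ _ = refl
  sqDigitSumFuel-irrelevant (suc f) (suc g) (suc n) (s≤s n≤f) (s≤s n≤g) =
    cong ((suc n % b) ^ 2 +_)
      (sqDigitSumFuel-irrelevant f g (suc n / b) (≤-trans q≤n n≤f) (≤-trans q≤n n≤g))
    where
    q≤n : suc n / b ≤ n
    q≤n = <⇒≤pred (m/n<m (suc n) b 1<b)

  -- The case of zero lets `decompose` split off three digits even from shorter numbers.
  sqDigitSum-step : ∀ n → sqDigitSum b n ≡ (n % b) ^ 2 + sqDigitSum b (n / b)
  sqDigitSum-step zero = sym (cong₂ (λ r q → r ^ 2 + sqDigitSum b q)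
    (m<n⇒m%n≡m (<⇒≤ 1<b)) (0/n≡0 b))
  sqDigitSum-step (suc n) = cong ((suc n % b) ^ 2 +_)
    (sqDigitSumFuel-irrelevant n (suc n / b) (suc n / b) (<⇒≤pred (m/n<m (suc n) b 1<b)) ≤-refl)

  sqDigitSum-+* : ∀ d q → d < b → sqDigitSum b (d + q * b) ≡ d ^ 2 + sqDigitSum b q
  sqDigitSum-+* d q d<b = trans (sqDigitSum-step (d + q * b))
    (cong₂ (λ x y → x ^ 2 + sqDigitSum b y)
      (trans ([m+kn]%n≡m%n d q b) (m<n⇒m%n≡m d<b))
      (trans (+-distrib-/-∣ʳ d (n∣m*n q)) (cong₂ _+_ (m<n⇒m/n≡0 d<b) (m*n/n≡m q b))))

  SucBound : ℕ → Set
  SucBound n = sqDigitSum b (suc n) + 3 ≤ sqDigitSum b n + 2 * b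

  -- Without a carry the last digit d becomes d + 1 ≤ b - 1, which adds 2d + 1 ≤ 2b - 3. With a
  -- carry the last digit becomes 0, and the bound for `n / b` takes over.
  sqDigitSum-suc : ∀ n → SucBound n
  sqDigitSum-suc = <-rec SucBound step
    where
    open ≤-Reasoning
    s = sqDigitSum b

    -- The squares are spelled out as `^ 2` unfolds, so that the identity applies to them
    -- definitionally.
    square-suc : ∀ d x → suc d * (suc d * 1) + x + 3 ≡ d * (d * 1) + x + 2 * suc (suc d)
    square-suc = solve-∀

    step : ∀ n → (∀ {m} → m < n → SucBound m) → SucBound n
    step n rec with m≤n⇒m<n∨m≡n (m%n<n n b)
    ... | inj₁ 1+d<b = begin
      s (suc n) + 3                         ≡⟨ cong (λ x → s (suc x) + 3) (m≡m%n+[m/n]*n n b) ⟩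
      s (suc (n % b) + n / b * b) + 3       ≡⟨ cong (_+ 3) (sqDigitSum-+* _ (n / b) 1+d<b) ⟩
      suc (n % b) ^ 2 + s (n / b) + 3       ≡⟨ square-suc (n % b) (s (n / b)) ⟩
      (n % b) ^ 2 + s (n / b) + 2 * suc (suc (n % b)) ≤⟨ +-monoʳ-≤ _ (*-monoʳ-≤ 2 1+d<b) ⟩
      (n % b) ^ 2 + s (n / b) + 2 * b       ≡⟨ cong (_+ 2 * b) (sqDigitSum-step n) ⟨
      s n + 2 * b                           ∎
    ... | inj₂ 1+d≡b = begin
      s (suc n) + 3                         ≡⟨ cong (λ x → s (suc x) + 3) (m≡m%n+[m/n]*n n b) ⟩
      s (suc (n % b) + n / b * b) + 3       ≡⟨ cong (λ x → s (x + n / b * b) + 3) 1+d≡b ⟩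
      s (suc (n / b) * b) + 3               ≡⟨ cong (_+ 3) (sqDigitSum-+* 0 (suc (n / b)) (<⇒≤ 1<b)) ⟩
      s (suc (n / b)) + 3                   ≤⟨ rec (quotient< n 1+d≡b) ⟩
      s (n / b) + 2 * b                     ≤⟨ +-monoˡ-≤ (2 * b) (m≤n+m (s (n / b)) ((n % b) ^ 2)) ⟩
      (n % b) ^ 2 + s (n / b) + 2 * b       ≡⟨ cong (_+ 2 * b) (sqDigitSum-step n) ⟨
      s n + 2 * b                           ∎
      where
      quotient< : ∀ n → suc (n % b) ≡ b → n / b < n
      -- A carry out of 0 would force `b` to be 1.
      quotient< zero    e = contradiction
        (trans (cong suc (sym (m<n⇒m%n≡m (<⇒≤ 1<b)))) e) (<⇒≢ 1<b)
      quotient< (suc n) _ = m/n<m (suc n) b 1<b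

  -- Splitting off the three lowest digits of a fixed point

  digitValue : ℕ → ℕ → ℕ → ℕ
  digitValue o w d = o + d * w ∸ d ^ 2

  -- The units digit contributes d − d² ≤ 0; the offset (b − 1)² keeps it in ℕ.
  offset : ℕ
  offset = pred b ^ 2

  E : List Bool
  E = image (digitValue offset 1) b ⊕ image (digitValue 0 b) b ⊕ image (digitValue 0 (b * b)) b

  -- The equation c = (p b³ - s p) + (x - offset) without subtraction, where x stands for offset +
  -- (r - s r).
  Decomposition : ℕ → ℕ → ℕ → Set
  Decomposition c p x = Member E x × c + sqDigitSum b p + offset ≡ p * (b * b * b) + x

  square≤ : ∀ d w → d ≤ w → d ^ 2 ≤ d * w
  square≤ d w d≤w = *-monoʳ-≤ d (≤-trans (≤-reflexive (*-identityʳ d)) d≤w)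

  decompose : ∀ c → HasFixedPoint c b → ∃₂ (Decomposition c)
  -- Adding the three digit squares to both sides removes the truncated subtractions in `v₀`, `v₁`,
  -- `v₂`, which `e₀`, `e₁`, `e₂` show to be exact.
  decompose c (a , _ , fix) = p , v₀ + (v₁ + v₂) , mem , +-cancelʳ-≡ (d₀ ^ 2 + (d₁ ^ 2 + d₂ ^ 2)) _ _ (begin
      c + s p + offset + (d₀ ^ 2 + (d₁ ^ 2 + d₂ ^ 2))
        ≡⟨ regroup c (s p) offset (d₀ ^ 2) (d₁ ^ 2) (d₂ ^ 2) ⟩
      offset + (c + (d₀ ^ 2 + (d₁ ^ 2 + (d₂ ^ 2 + s p))))
        ≡⟨ cong (λ x → offset + (c + x)) digitSum ⟨
      offset + (c + s a)
        ≡⟨ cong (offset +_) (trans fix expansion) ⟩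
      offset + (d₀ + (d₁ + (d₂ + p * b) * b) * b)
        ≡⟨ expand offset d₀ d₁ d₂ p b ⟩
      p * (b * b * b) + ((offset + d₀ * 1) + ((0 + d₁ * b) + (0 + d₂ * (b * b))))
        ≡⟨ cong (p * (b * b * b) +_) (cong₂ _+_ e₀ (cong₂ _+_ e₁ e₂)) ⟨
      p * (b * b * b) + ((v₀ + d₀ ^ 2) + ((v₁ + d₁ ^ 2) + (v₂ + d₂ ^ 2)))
        ≡⟨ collect (p * (b * b * b)) v₀ v₁ v₂ (d₀ ^ 2) (d₁ ^ 2) (d₂ ^ 2) ⟩
      p * (b * b * b) + (v₀ + (v₁ + v₂)) + (d₀ ^ 2 + (d₁ ^ 2 + d₂ ^ 2)) ∎)
    where
    open ≡-Reasoning
    s = sqDigitSum b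
    q₁ = a / b
    q₂ = q₁ / b
    p  = q₂ / b
    d₀ = a % b
    d₁ = q₁ % b
    d₂ = q₂ % b
    v₀ = digitValue offset 1 d₀
    v₁ = digitValue 0 b d₁
    v₂ = digitValue 0 (b * b) d₂

    mem : Member E (v₀ + (v₁ + v₂))
    mem = ⊕-+ (image (digitValue offset 1) b) _ (image-mem _ (m%n<n a b))
      (⊕-+ (image (digitValue 0 b) b) _ (image-mem _ (m%n<n q₁ b)) (image-mem _ (m%n<n q₂ b)))

    digitSum : s a ≡ d₀ ^ 2 + (d₁ ^ 2 + (d₂ ^ 2 + s p))
    digitSum = trans (sqDigitSum-step a) (cong (d₀ ^ 2 +_)
      (trans (sqDigitSum-step q₁) (cong (d₁ ^ 2 +_) (sqDigitSum-step q₂))))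

    expansion : a ≡ d₀ + (d₁ + (d₂ + p * b) * b) * b
    expansion = trans (m≡m%n+[m/n]*n a b) (cong (λ x → d₀ + x * b)
      (trans (m≡m%n+[m/n]*n q₁ b) (cong (λ x → d₁ + x * b) (m≡m%n+[m/n]*n q₂ b))))

    e₀ : v₀ + d₀ ^ 2 ≡ offset + d₀ * 1
    e₀ = m∸n+n≡m
      (≤-trans (^-monoˡ-≤ 2 (<⇒≤pred (m%n<n a b))) (m≤m+n offset _))
    e₁ : v₁ + d₁ ^ 2 ≡ 0 + d₁ * b
    e₁ = m∸n+n≡m (square≤ d₁ b (m%n≤n q₁ b))
    e₂ : v₂ + d₂ ^ 2 ≡ 0 + d₂ * (b * b)
    e₂ = m∸n+n≡m (square≤ d₂ (b * b) (≤-trans (m%n≤n q₂ b) (m≤m*n b b)))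

    regroup : ∀ c s o x y z → c + s + o + (x + (y + z)) ≡ o + (c + (x + (y + (z + s))))
    regroup = solve-∀
    expand : ∀ o x y z p b → o + (x + (y + (z + p * b) * b) * b)
      ≡ p * (b * b * b) + ((o + x * 1) + ((0 + y * b) + (0 + z * (b * b))))
    expand = solve-∀
    collect : ∀ p u v w x y z → p + ((u + x) + ((v + y) + (w + z)))
      ≡ p + (u + (v + w)) + (x + (y + z))
    collect = solve-∀

  -- Separation of the translates

  module _ (sparse : length E + 2 * b < 3 + b * b * b) where

    -- Between p and p + 1 the translation p b³ - s p grows by at least b³ - (2b - 3), by
    -- `sqDigitSum-suc`. Each further step cannot decrease it, since `sparse` gives 2b ≤ 3 + b³.
    translates-apart : ∀ {p q} → p < q →
      sqDigitSum b q + (p * (b * b * b) + (3 + b * b * b))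
        ≤ sqDigitSum b p + (2 * b + q * (b * b * b))
    translates-apart {p} {suc q} p<1+q with m<1+n⇒m<n∨m≡n p<1+q
    ... | inj₂ refl = begin
      s (suc p) + (p * B + (3 + B))  ≡⟨ lhs (s (suc p)) (p * B) B ⟩
      s (suc p) + 3 + (B + p * B)    ≤⟨ +-monoˡ-≤ _ (sqDigitSum-suc p) ⟩
      s p + 2 * b + (B + p * B)      ≡⟨ +-assoc (s p) _ _ ⟩
      s p + (2 * b + (B + p * B))    ∎
      where
      open ≤-Reasoning
      s = sqDigitSum b
      B = b * b * b
      lhs : ∀ t y B → t + (y + (3 + B)) ≡ t + 3 + (B + y)
      lhs = solve-∀
    ... | inj₁ p<q = begin
      s (suc q) + (p * B + (3 + B))  ≡⟨ lhs (s (suc q)) (p * B) B ⟩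
      s (suc q) + 3 + (p * B + B)    ≤⟨ +-monoˡ-≤ _ (sqDigitSum-suc q) ⟩
      s q + 2 * b + (p * B + B)      ≤⟨ +-monoˡ-≤ _ (+-monoʳ-≤ (s q) 2b≤3+B) ⟩
      s q + (3 + B) + (p * B + B)    ≡⟨ mid (s q) (p * B) B ⟩
      s q + (p * B + (3 + B)) + B    ≤⟨ +-monoˡ-≤ B (translates-apart p<q) ⟩
      s p + (2 * b + q * B) + B      ≡⟨ rhs (s p) (2 * b) (q * B) B ⟩
      s p + (2 * b + (B + q * B))    ∎
      where
      open ≤-Reasoning
      s = sqDigitSum b
      B = b * b * b
      2b≤3+B : 2 * b ≤ 3 + B
      2b≤3+B = ≤-trans (m≤n+m (2 * b) (length E)) (<⇒≤ sparse)
      lhs : ∀ t y B → t + (y + (3 + B)) ≡ t + 3 + (y + B)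
      lhs = solve-∀
      mid : ∀ t y B → t + (3 + B) + (y + B) ≡ t + (y + (3 + B)) + B
      mid = solve-∀
      rhs : ∀ t u y B → t + (u + y) + B ≡ t + (u + (B + y))
      rhs = solve-∀

    -- By `sparse` the least gap b³ - 2b + 3 exceeds `length E`.
    separated : ∀ {p q} → p < q →
      ¬ (q * (b * b * b) + sqDigitSum b p ≤ length E + (sqDigitSum b q + p * (b * b * b)))
    separated {p} {q} p<q close = <⇒≱ sparse (+-cancelˡ-≤ (s q + p * B) _ _ (begin
      s q + p * B + (3 + B)              ≡⟨ +-assoc (s q) _ _ ⟩
      s q + (p * B + (3 + B))            ≤⟨ translates-apart p<q ⟩
      s p + (2 * b + q * B)              ≡⟨ swap (s p) (2 * b) (q * B) ⟩
      q * B + s p + 2 * b                ≤⟨ +-monoˡ-≤ (2 * b) close ⟩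
      length E + (s q + p * B) + 2 * b   ≡⟨ out (length E) (s q + p * B) (2 * b) ⟩
      s q + p * B + (length E + 2 * b)   ∎))
      where
      open ≤-Reasoning
      s = sqDigitSum b
      B = b * b * b
      swap : ∀ x y z → x + (y + z) ≡ z + x + y
      swap = solve-∀
      out : ∀ x y z → x + y + z ≡ y + (x + z)
      out = solve-∀

    -- The difference of the two translations is 1 + x - y if p < q, and y - x - 1 if q < p. Both
    -- are at most `length E`, because members of `E` lie below it, and this contradicts
    -- `separated`.
    same-translate : ∀ {c p q x y} → Decomposition c p x → Decomposition (suc c) q y → p ≡ q
    same-translate {c} {p} {q} {x} {y} (x∈E , eqx) (y∈E , eqy) with <-cmp p q
    ... | tri≈ _ p≡q _ = p≡q
    ... | tri< p<q _ _ = contradiction (begin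
      q * B + s p             ≤⟨ m≤m+n _ y ⟩
      q * B + s p + y         ≡⟨ swap₁ (q * B) (s p) y ⟩
      s p + (q * B + y)       ≡⟨ cong (s p +_) eqy ⟨
      s p + (suc c + s q + offset) ≡⟨ swap₂ (s p) c (s q) offset ⟩
      suc (s q) + (c + s p + offset) ≡⟨ cong (suc (s q) +_) eqx ⟩
      suc (s q) + (p * B + x) ≡⟨ swap₃ (s q) (p * B) x ⟩
      suc x + (s q + p * B)   ≤⟨ +-monoˡ-≤ _ (Member-<-length E x∈E) ⟩
      length E + (s q + p * B) ∎) (separated p<q)
      where
      open ≤-Reasoning
      s = sqDigitSum b
      B = b * b * b
      swap₁ : ∀ u v w → u + v + w ≡ v + (u + w)
      swap₁ = solve-∀
      swap₂ : ∀ t c u o → t + (suc c + u + o) ≡ suc u + (c + t + o)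
      swap₂ = solve-∀
      swap₃ : ∀ t u v → suc t + (u + v) ≡ suc v + (t + u)
      swap₃ = solve-∀
    ... | tri> _ _ q<p = contradiction (begin
      p * B + s q             ≤⟨ m≤m+n _ (suc x) ⟩
      p * B + s q + suc x     ≡⟨ swap₁ (p * B) (s q) x ⟩
      suc (s q) + (p * B + x) ≡⟨ cong (suc (s q) +_) eqx ⟨
      suc (s q) + (c + s p + offset) ≡⟨ swap₂ (s q) c (s p) offset ⟩
      s p + (suc c + s q + offset) ≡⟨ cong (s p +_) eqy ⟩
      s p + (q * B + y)       ≡⟨ swap₃ (s p) (q * B) y ⟩
      y + (s p + q * B)       ≤⟨ +-monoˡ-≤ _ (<⇒≤ (Member-<-length E y∈E)) ⟩
      length E + (s p + q * B) ∎) (separated q<p)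
      where
      open ≤-Reasoning
      s = sqDigitSum b
      B = b * b * b
      swap₁ : ∀ u v x → u + v + suc x ≡ suc v + (u + x)
      swap₁ = solve-∀
      swap₂ : ∀ t c u o → suc t + (c + u + o) ≡ u + (suc c + t + o)
      swap₂ = solve-∀
      swap₃ : ∀ t u v → t + (u + v) ≡ v + (t + u)
      swap₃ = solve-∀

    -- From oases to runs in `E`

    no-long-oasis : ∀ K → T (runs≤ K K E) → ∀ k c₀ → K < k → ¬ IsOasis b k c₀
    no-long-oasis K short k c₀ K<k oasis = no-long-run K K E x₀ short ≤-refl run
      where
      open ≡-Reasoning
      fixed : ∀ i → i ≤ K → HasFixedPoint (c₀ + i) b
      fixed i i≤K = oasis i (≤-trans (s≤s i≤K) K<k)

      initial = decompose (c₀ + 0) (fixed 0 z≤n)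
      p₀ = proj₁ initial
      x₀ = proj₁ (proj₂ initial)

      -- As `p₀` stays fixed along the oasis, the member of `E` grows in step with c.
      run′ : ∀ i → i ≤ K → Decomposition (c₀ + i) p₀ (x₀ + i)
      run′ zero    _   = subst (Decomposition (c₀ + 0) p₀) (sym (+-identityʳ x₀)) (proj₂ (proj₂ initial))
      run′ (suc i) i<K with run′ i (<⇒≤ i<K) | decompose (c₀ + suc i) (fixed (suc i) i<K)
      ... | prev@(_ , eqx) | q , y , next@(y∈E , eqy)
        with refl ← same-translate {c₀ + i} {p₀} {q} {x₀ + i} {y} prev
               (subst (λ c → Decomposition c q y) (+-suc c₀ i) next)
        = subst (Decomposition (c₀ + suc i) p₀) y≡ next
        where
        y≡ : y ≡ x₀ + suc i
        y≡ = +-cancelˡ-≡ (p₀ * (b * b * b)) _ _ (begin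
          p₀ * (b * b * b) + y                          ≡⟨ eqy ⟨
          c₀ + suc i + sqDigitSum b p₀ + offset         ≡⟨ cong (λ c → c + sqDigitSum b p₀ + offset) (+-suc c₀ i) ⟩
          suc (c₀ + i + sqDigitSum b p₀ + offset)       ≡⟨ cong suc eqx ⟩
          suc (p₀ * (b * b * b) + (x₀ + i))             ≡⟨ +-suc _ _ ⟨
          p₀ * (b * b * b) + suc (x₀ + i)               ≡⟨ cong (p₀ * (b * b * b) +_) (+-suc x₀ i) ⟨
          p₀ * (b * b * b) + (x₀ + suc i)               ∎)

      run : ∀ i → i ≤ K → Member E (x₀ + i)
      run i i≤K = proj₁ (run′ i i≤K)

-- Certificates for the ten bases

AllFixed : (b : ℕ) .{{_ : NonZero b}} → ∀ {K} → ℕ → Vec ℕ K → Set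
AllFixed b c₀ as = ∀ i → IsFixedPoint (c₀ + toℕ i) b (lookup as i)

-- The last four hypotheses are decided by evaluation, so for concrete data they reduce to the unit
-- type and `_` fills them.
maxOasisLength : ∀ b .{{_ : NonZero b}} c₀ {K} (as : Vec ℕ K)
  (1<b : True (1 <? b))
  (fixed : True (all? λ i → (0 <? lookup as i) ×-dec (S (c₀ + toℕ i) b (lookup as i) ≟ lookup as i)))
  (sparse : True (length (E b (toWitness 1<b)) + 2 * b <? 3 + b * b * b))
  (short : T (runs≤ K K (E b (toWitness 1<b)))) →
  MaxOasisLength b K
maxOasisLength b c₀ {K} as 1<b fixed sparse short =
  (c₀ , λ i i<K → lookup as (fromℕ< i<K) ,
    subst (λ j → IsFixedPoint (c₀ + j) b (lookup as (fromℕ< i<K))) (toℕ-fromℕ< i<K)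
      (toWitness fixed (fromℕ< i<K))) ,
  no-long-oasis b (toWitness 1<b) (toWitness sparse) K short

theorem11 : MaxOasisLength 2 2 × MaxOasisLength 4 6 × MaxOasisLength 6 5
    × MaxOasisLength 8 8 × MaxOasisLength 10 8 × MaxOasisLength 12 8
    × MaxOasisLength 14 8 × MaxOasisLength 16 8 × MaxOasisLength 18 8
    × MaxOasisLength 20 9
theorem11 =
    -- Each entry gives the base, the first c of an oasis, and one fixed point for each successive
    -- c. Here 4 is 100 in binary, with 3 + 1 = 4, and 6 is 110, with 4 + 2 = 6.
    maxOasisLength 2 3 (4 ∷ 6 ∷ []) _ _ _ _
  , maxOasisLength 4 28 (32 ∷ 38 ∷ 42 ∷ 36 ∷ 40 ∷ 51 ∷ []) _ _ _ _
  , maxOasisLength 6 5 (6 ∷ 14 ∷ 20 ∷ 12 ∷ 18 ∷ []) _ _ _ _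
  , maxOasisLength 8 304 (347 ∷ 338 ∷ 391 ∷ 336 ∷ 346 ∷ 354 ∷ 344 ∷ 352 ∷ []) _ _ _ _
  , maxOasisLength 10 487 (544 ∷ 554 ∷ 522 ∷ 533 ∷ 520 ∷ 609 ∷ 543 ∷ 532 ∷ []) _ _ _ _
  , maxOasisLength 12 172 (207 ∷ 194 ∷ 299 ∷ 192 ∷ 206 ∷ 218 ∷ 204 ∷ 216 ∷ []) _ _ _ _
  , maxOasisLength 14 421 (434 ∷ 451 ∷ 601 ∷ 480 ∷ 494 ∷ 450 ∷ 465 ∷ 448 ∷ []) _ _ _ _
  , maxOasisLength 16 559 (628 ∷ 644 ∷ 594 ∷ 611 ∷ 592 ∷ 799 ∷ 627 ∷ 610 ∷ []) _ _ _ _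
  , maxOasisLength 18 1663 (1768 ∷ 1786 ∷ 1730 ∷ 1749 ∷ 1728 ∷ 1960 ∷ 1767 ∷ 1748 ∷ []) _ _ _ _
  , maxOasisLength 20 5124 (5383 ∷ 5362 ∷ 5699 ∷ 5360 ∷ 5382 ∷ 5402 ∷ 5380 ∷ 5400 ∷ 5617 ∷ []) _ _ _ _
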